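{- Let $n\geq 2$ be an integer. Then $$J_{n-2} < \left(\sum_{k=n}^{\infty} \frac{1}{J_{k}}\right)^{ -1} < 4\,(J_{n-2}+1).$$
   Context: The Jacobsthal numbers $(J_n)_{n\ge 0}$ are defined by $J_0=0$, $J_1=1$ and $J_{n+2}=J_{n+1}+2J_n$ for $n\ge 0$; the first terms are $0,1,1,3,5,11,21,43,85,\dots$. -}

module Defs where

open import Data.Nat as ℕ using (ℕ; zero; suc)
import Data.Nat.Properties as ℕ
open import Data.Integer using (+_)
open import Data.Rational as ℚ using (ℚ; 0ℚ; 1ℚ; ½)
open import Data.Rational.Properties as ℚ using (module ≤-Reasoning)
open import Data.Rational.Solver using (module +-*-Solver)
open import Data.Product using (∃-syntax; _×_; _,_)
open import Data.Sum using (_⊎_; inj₁; inj₂)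
open import Relation.Nullary using (yes; no; contradiction)
open import Relation.Binary.PropositionalEquality
  using (_≡_; _≢_; refl; sym; trans; cong; cong₂; subst; subst₂)

J : ℕ → ℕ
J 0             = 0
J 1             = 1
J (suc (suc n)) = J (suc n) ℕ.+ 2 ℕ.* J n

------------------------------------------------------------------------
-- Rational reciprocal, made total by 1/0 = 0.

recip : ℚ → ℚ
recip q with q ℚ.≟ 0ℚ
... | yes _  = 0ℚ
... | no q≢0 = ℚ.1/_ q {{ℚ.≢-nonZero q≢0}}

recip-inverseˡ : ∀ q → q ≢ 0ℚ → recip q ℚ.* q ≡ 1ℚ
recip-inverseˡ q q≢0 with q ℚ.≟ 0ℚ
... | yes q≡0 = contradiction q≡0 q≢0
... | no  q≢0′ = ℚ.*-inverseˡ q {{ℚ.≢-nonZero q≢0′}}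

fromℕ : ℕ → ℚ
fromℕ m = + m ℚ./ 1

------------------------------------------------------------------------
-- Real numbers as Cauchy sequences of rationals. Two sequences with the
-- same limit are not identified; the relations below respect that
-- equivalence.

Cauchy : (ℕ → ℚ) → Set
Cauchy x = ∀ ε → 0ℚ ℚ.< ε →
  ∃[ N ] (∀ m n → N ℕ.≤ m → N ℕ.≤ n → ℚ.∣ x m ℚ.- x n ∣ ℚ.< ε)

record ℝ : Set where
  constructor mkℝ
  field
    seq    : ℕ → ℚ
    cauchy : Cauchy seq

open ℝ public

ι : ℚ → ℝ
ι q .seq _ = q
ι q .cauchy ε 0<ε = 0 , λ _ _ _ _ →
  subst (ℚ._< ε) (sym (cong ℚ.∣_∣ (ℚ.+-inverseʳ q))) 0<ε

infix 4 _<ℝ_ _#_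

-- The limits differ by at least some positive rational; eventual pointwise
-- strict inequality would be too weak.
_<ℝ_ : ℝ → ℝ → Set
x <ℝ y = ∃[ ε ] (0ℚ ℚ.< ε × ∃[ N ] (∀ n → N ℕ.≤ n → seq x n ℚ.+ ε ℚ.≤ seq y n))

-- Apartness, the constructive form of x ≠ y.
_#_ : ℝ → ℝ → Set
x # y = x <ℝ y ⊎ y <ℝ x

private
  dist-swap : ∀ a b c d → (a ℚ.- b) ℚ.- (c ℚ.- d) ≡ (a ℚ.- c) ℚ.+ (d ℚ.- b)
  dist-swap = solve 4 (λ a b c d →
    (a :- b) :- (c :- d) := (a :- c) :+ (d :- b)) refl
    where open +-*-Solver

  half+half : ∀ ε → ε ℚ.* ½ ℚ.+ ε ℚ.* ½ ≡ ε
  half+half ε = trans (sym (ℚ.*-distribˡ-+ ε ½ ½)) (ℚ.*-identityʳ ε)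

  *-pos : ∀ {p q} → 0ℚ ℚ.< p → 0ℚ ℚ.< q → 0ℚ ℚ.< p ℚ.* q
  *-pos {p} {q} 0<p 0<q = subst (ℚ._< p ℚ.* q) (ℚ.*-zeroˡ q)
    (ℚ.*-monoˡ-<-pos q {{ℚ.positive 0<q}} 0<p)

  ≤∣∣ : ∀ p → p ℚ.≤ ℚ.∣ p ∣
  ≤∣∣ p with ℚ.≤-total 0ℚ p
  ... | inj₁ 0≤p = ℚ.≤-reflexive (sym (ℚ.0≤p⇒∣p∣≡p 0≤p))
  ... | inj₂ p≤0 = ℚ.≤-trans p≤0 (ℚ.0≤∣p∣ p)

  ∣∣-lub : ∀ {p q} → p ℚ.≤ q → ℚ.- p ℚ.≤ q → ℚ.∣ p ∣ ℚ.≤ q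
  ∣∣-lub {p} p≤q -p≤q with ℚ.∣p∣≡p∨∣p∣≡-p p
  ... | inj₁ eq = subst (ℚ._≤ _) (sym eq) p≤q
  ... | inj₂ eq = subst (ℚ._≤ _) (sym eq) -p≤q

  ∣∣-reverse : ∀ a b → ℚ.∣ a ∣ ℚ.- ℚ.∣ b ∣ ℚ.≤ ℚ.∣ a ℚ.- b ∣
  ∣∣-reverse a b = begin
    ℚ.∣ a ∣ ℚ.- ℚ.∣ b ∣
      ≡⟨ cong (λ t → ℚ.∣ t ∣ ℚ.- ℚ.∣ b ∣) (e a b) ⟩
    ℚ.∣ (a ℚ.- b) ℚ.+ b ∣ ℚ.- ℚ.∣ b ∣
      ≤⟨ ℚ.+-monoˡ-≤ (ℚ.- ℚ.∣ b ∣) (ℚ.∣p+q∣≤∣p∣+∣q∣ (a ℚ.- b) b) ⟩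
    ℚ.∣ a ℚ.- b ∣ ℚ.+ ℚ.∣ b ∣ ℚ.- ℚ.∣ b ∣
      ≡⟨ f ℚ.∣ a ℚ.- b ∣ ℚ.∣ b ∣ ⟩
    ℚ.∣ a ℚ.- b ∣ ∎
    where
    open ≤-Reasoning
    open +-*-Solver
    e : ∀ a b → a ≡ (a ℚ.- b) ℚ.+ b
    e = solve 2 (λ a b → a := (a :- b) :+ b) refl
    f : ∀ u v → u ℚ.+ v ℚ.- v ≡ u
    f = solve 2 (λ u v → u :+ v :- v := u) refl

  ∣-∣-comm : ∀ a b → ℚ.∣ a ℚ.- b ∣ ≡ ℚ.∣ b ℚ.- a ∣
  ∣-∣-comm a b = trans (sym (ℚ.∣-p∣≡∣p∣ (a ℚ.- b))) (cong ℚ.∣_∣ (e a b))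
    where
    open +-*-Solver
    e : ∀ a b → ℚ.- (a ℚ.- b) ≡ b ℚ.- a
    e = solve 2 (λ a b → :- (a :- b) := b :- a) refl

infixl 6 _-ℝ_

_-ℝ_ : ℝ → ℝ → ℝ
(x -ℝ y) .seq n = seq x n ℚ.- seq y n
(x -ℝ y) .cauchy ε 0<ε
  with cauchy x (ε ℚ.* ½) (*-pos 0<ε (ℚ.positive⁻¹ ½))
     | cauchy y (ε ℚ.* ½) (*-pos 0<ε (ℚ.positive⁻¹ ½))
... | M , hx | N , hy = M ℕ.⊔ N , λ m n p q → begin-strict
  ℚ.∣ (seq x m ℚ.- seq y m) ℚ.- (seq x n ℚ.- seq y n) ∣
    ≡⟨ cong ℚ.∣_∣ (dist-swap (seq x m) (seq y m) (seq x n) (seq y n)) ⟩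
  ℚ.∣ (seq x m ℚ.- seq x n) ℚ.+ (seq y n ℚ.- seq y m) ∣
    ≤⟨ ℚ.∣p+q∣≤∣p∣+∣q∣ (seq x m ℚ.- seq x n) (seq y n ℚ.- seq y m) ⟩
  ℚ.∣ seq x m ℚ.- seq x n ∣ ℚ.+ ℚ.∣ seq y n ℚ.- seq y m ∣
    <⟨ ℚ.+-mono-< (hx m n (ℕ.m⊔n≤o⇒m≤o M N p) (ℕ.m⊔n≤o⇒m≤o M N q))
                  (hy n m (ℕ.m⊔n≤o⇒n≤o M N q) (ℕ.m⊔n≤o⇒n≤o M N p)) ⟩
  ε ℚ.* ½ ℚ.+ ε ℚ.* ½
    ≡⟨ half+half ε ⟩
  ε ∎
  where open ≤-Reasoning

∣_∣ℝ : ℝ → ℝ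
∣ x ∣ℝ .seq n = ℚ.∣ seq x n ∣
∣ x ∣ℝ .cauchy ε 0<ε with cauchy x ε 0<ε
... | N , h = N , λ m n p q → ℚ.≤-<-trans (bound (seq x m) (seq x n)) (h m n p q)
  where
  open +-*-Solver
  flip : ∀ u v → ℚ.- (u ℚ.- v) ≡ v ℚ.- u
  flip = solve 2 (λ u v → :- (u :- v) := v :- u) refl
  bound : ∀ a b → ℚ.∣ ℚ.∣ a ∣ ℚ.- ℚ.∣ b ∣ ∣ ℚ.≤ ℚ.∣ a ℚ.- b ∣
  bound a b = ∣∣-lub (∣∣-reverse a b)
    (subst₂ ℚ._≤_ (sym (flip ℚ.∣ a ∣ ℚ.∣ b ∣)) (∣-∣-comm b a) (∣∣-reverse b a))

private
  apart-bound : ∀ x → x # ι 0ℚ →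
    ∃[ ε ] (0ℚ ℚ.< ε × ∃[ N ] (∀ n → N ℕ.≤ n → ε ℚ.≤ ℚ.∣ seq x n ∣))
  apart-bound x (inj₁ (ε , 0<ε , N , h)) = ε , 0<ε , N , λ n p → begin
    ε                               ≡⟨ e (seq x n) ε ⟩
    ℚ.- seq x n ℚ.+ (seq x n ℚ.+ ε) ≤⟨ ℚ.+-monoʳ-≤ (ℚ.- seq x n) (h n p) ⟩
    ℚ.- seq x n ℚ.+ 0ℚ              ≡⟨ ℚ.+-identityʳ (ℚ.- seq x n) ⟩
    ℚ.- seq x n                     ≤⟨ ≤∣∣ (ℚ.- seq x n) ⟩
    ℚ.∣ ℚ.- seq x n ∣               ≡⟨ ℚ.∣-p∣≡∣p∣ (seq x n) ⟩
    ℚ.∣ seq x n ∣                   ∎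
    where
    open ≤-Reasoning
    open +-*-Solver
    e : ∀ u v → v ≡ ℚ.- u ℚ.+ (u ℚ.+ v)
    e = solve 2 (λ u v → v := :- u :+ (u :+ v)) refl
  apart-bound x (inj₂ (ε , 0<ε , N , h)) = ε , 0<ε , N , λ n p →
    ℚ.≤-trans (subst (ℚ._≤ seq x n) (ℚ.+-identityˡ ε) (h n p)) (≤∣∣ (seq x n))

  bound⇒≢0 : ∀ {ε a} → 0ℚ ℚ.< ε → ε ℚ.≤ ℚ.∣ a ∣ → a ≢ 0ℚ
  bound⇒≢0 0<ε ε≤ refl = ℚ.<-irrefl refl (ℚ.<-≤-trans 0<ε ε≤)

  recip-dist : ∀ {δ ε a b} → 0ℚ ℚ.< ε → ε ℚ.≤ ℚ.∣ a ∣ → ε ℚ.≤ ℚ.∣ b ∣ →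
    ℚ.∣ a ℚ.- b ∣ ℚ.< δ ℚ.* (ε ℚ.* ε) → ℚ.∣ recip a ℚ.- recip b ∣ ℚ.< δ
  recip-dist {δ} {ε} {a} {b} 0<ε εa εb h =
    ℚ.*-cancelʳ-<-nonNeg (ε ℚ.* ε)
      {{ℚ.nonNegative (ℚ.<⇒≤ (*-pos 0<ε 0<ε))}} (begin-strict
    d ℚ.* (ε ℚ.* ε)
      ≤⟨ ℚ.*-monoˡ-≤-nonNeg d {{ℚ.∣-∣-nonNeg (a′ ℚ.- b′)}} ε²≤ ⟩
    d ℚ.* (ℚ.∣ a ∣ ℚ.* ℚ.∣ b ∣)
      ≡⟨ cong (d ℚ.*_) (sym (ℚ.∣p*q∣≡∣p∣*∣q∣ a b)) ⟩
    d ℚ.* ℚ.∣ a ℚ.* b ∣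
      ≡⟨ sym (ℚ.∣p*q∣≡∣p∣*∣q∣ (a′ ℚ.- b′) (a ℚ.* b)) ⟩
    ℚ.∣ (a′ ℚ.- b′) ℚ.* (a ℚ.* b) ∣
      ≡⟨ cong ℚ.∣_∣ (e a b a′ b′) ⟩
    ℚ.∣ (a′ ℚ.* a) ℚ.* b ℚ.- (b′ ℚ.* b) ℚ.* a ∣
      ≡⟨ cong₂ (λ s t → ℚ.∣ s ℚ.* b ℚ.- t ℚ.* a ∣)
           (recip-inverseˡ a (bound⇒≢0 0<ε εa)) (recip-inverseˡ b (bound⇒≢0 0<ε εb)) ⟩
    ℚ.∣ 1ℚ ℚ.* b ℚ.- 1ℚ ℚ.* a ∣
      ≡⟨ cong₂ (λ s t → ℚ.∣ s ℚ.- t ∣) (ℚ.*-identityˡ b) (ℚ.*-identityˡ a) ⟩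
    ℚ.∣ b ℚ.- a ∣
      ≡⟨ ∣-∣-comm b a ⟩
    ℚ.∣ a ℚ.- b ∣
      <⟨ h ⟩
    δ ℚ.* (ε ℚ.* ε) ∎)
    where
    open ≤-Reasoning
    a′ b′ d : ℚ
    a′ = recip a
    b′ = recip b
    d  = ℚ.∣ a′ ℚ.- b′ ∣
    ε²≤ : ε ℚ.* ε ℚ.≤ ℚ.∣ a ∣ ℚ.* ℚ.∣ b ∣
    ε²≤ = ℚ.≤-trans
      (ℚ.*-monoˡ-≤-nonNeg ε {{ℚ.nonNegative (ℚ.<⇒≤ 0<ε)}} εb)
      (ℚ.*-monoʳ-≤-nonNeg ℚ.∣ b ∣ {{ℚ.∣-∣-nonNeg b}} εa)
    e : ∀ a b a′ b′ → (a′ ℚ.- b′) ℚ.* (a ℚ.* b) ≡ (a′ ℚ.* a) ℚ.* b ℚ.- (b′ ℚ.* b) ℚ.* a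
    e = solve 4 (λ a b a′ b′ →
      (a′ :- b′) :* (a :* b) := (a′ :* a) :* b :- (b′ :* b) :* a) refl
      where open +-*-Solver

-- Termwise reciprocal; apartness from 0 makes all but finitely many terms
-- nonzero, so the value recip 0ℚ = 0ℚ does not affect the limit.
inv : (x : ℝ) → x # ι 0ℚ → ℝ
inv x x#0 .seq n = recip (seq x n)
inv x x#0 .cauchy δ 0<δ with apart-bound x x#0
... | ε , 0<ε , M , hb with cauchy x (δ ℚ.* (ε ℚ.* ε)) (*-pos 0<δ (*-pos 0<ε 0<ε))
...   | N , hc = M ℕ.⊔ N , λ m n p q →
  recip-dist 0<ε (hb m (ℕ.m⊔n≤o⇒m≤o M N p)) (hb n (ℕ.m⊔n≤o⇒m≤o M N q))
    (hc m n (ℕ.m⊔n≤o⇒n≤o M N p) (ℕ.m⊔n≤o⇒n≤o M N q))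

------------------------------------------------------------------------
-- Infinite series with rational terms

partialSum : (ℕ → ℚ) → ℕ → ℚ
partialSum a zero    = 0ℚ
partialSum a (suc m) = partialSum a m ℚ.+ a m

HasSum : (ℕ → ℚ) → ℝ → Set
HasSum a S = ∀ ε → 0ℚ ℚ.< ε →
  ∃[ N ] (∀ m → N ℕ.≤ m → ∣ ι (partialSum a m) -ℝ S ∣ℝ <ℝ ι ε)

-- The terms of ∑_{k ≥ n} 1/J_k, indexed by i = k - n. For n ≥ 1 every
-- denominator is positive.
tailTerm : ℕ → ℕ → ℚ
tailTerm n i = recip (fromℕ (J (n ℕ.+ i)))

{-# OPTIONS --safe #-}
-- For k ≥ 2 the ratio J (k + 1) / J k is at least 5/3, so ∑_{k ≥ n} 1/J_k
-- lies between its first term 1/J_n and 5/2 · 1/J_n. Hence its inverse lies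
-- between 2/5 · J_n and J_n, and 5 J_{n-2} + 1 ≤ 2 J_n, J_n ≤ 4 J_{n-2} + 1.
module Submission where

open import Defs
open import Data.Nat using (ℕ; _≤_; _∸_; _+_; _*_)
open import Data.Rational using (0ℚ)
open import Data.Product using (Σ-syntax; _×_)

open import Data.Nat as ℕ using (zero; suc; z≤n; s≤s)
import Data.Nat.Properties as ℕ
import Data.Nat.Solver as ℕ
open import Data.Integer as ℤ using (+_)
import Data.Integer.Properties as ℤ
open import Data.Rational as ℚ using (ℚ; mkℚ; 1ℚ; ½)
import Data.Rational.Properties as ℚ
open import Data.Rational.Solver using (module +-*-Solver)
import Data.Rational.Unnormalised as ℚᵘ
import Data.Rational.Unnormalised.Properties as ℚᵘ
open import Data.Product using (∃-syntax; _,_; proj₁; proj₂)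
open import Data.Sum using (inj₁; inj₂)
open import Relation.Binary.PropositionalEquality
  using (_≡_; refl; sym; trans; cong; cong₂; subst; subst₂)

-- Inequalities between Jacobsthal numbers.

-- The difference `J (suc m) - 2 * J m` is 1 or -1, with alternating sign, because the recurrence
-- negates it at each step. This is why each bound at `suc m` comes from the opposite bound at `m`.
J-suc-bounds : ∀ m → J (suc m) ≤ 2 * J m + 1 × 2 * J m ≤ J (suc m) + 1
J-suc-bounds zero    = s≤s z≤n , z≤n
J-suc-bounds (suc m) with J-suc-bounds m
... | upper , lower = (begin
    x + 2 * y          ≤⟨ ℕ.+-monoʳ-≤ x lower ⟩
    x + (x + 1)        ≡⟨ solve 1 (λ x → x :+ (x :+ con 1) := con 2 :* x :+ con 1) refl x ⟩
    2 * x + 1          ∎) , (begin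
    2 * x              ≡⟨ solve 1 (λ x → con 2 :* x := x :+ x) refl x ⟩
    x + x              ≤⟨ ℕ.+-monoʳ-≤ x upper ⟩
    x + (2 * y + 1)    ≡⟨ sym (ℕ.+-assoc x (2 * y) 1) ⟩
    x + 2 * y + 1      ∎)
  where
  open ℕ.≤-Reasoning
  open ℕ.+-*-Solver
  x y : ℕ
  x = J (suc m)
  y = J m

0<J[1+m] : ∀ m → 1 ≤ J (suc m)
0<J[1+m] zero    = s≤s z≤n
0<J[1+m] (suc m) = ℕ.≤-trans (0<J[1+m] m) (ℕ.m≤m+n _ _)

J≤J[1+m] : ∀ m → J m ≤ J (suc m)
J≤J[1+m] zero    = z≤n
J≤J[1+m] (suc m) = ℕ.m≤m+n _ _

-- Linear growth is crude, but it is enough to make the reciprocals tend to 0.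
m<J[2+m] : ∀ m → m ℕ.< J (2 + m)
m<J[2+m] zero    = s≤s z≤n
m<J[2+m] (suc m) = begin
  2 + m                        ≡⟨ ℕ.+-comm 1 (1 + m) ⟩
  1 + m + 1                    ≤⟨ ℕ.+-mono-≤ (m<J[2+m] m)
                                    (ℕ.≤-trans (0<J[1+m] m) (ℕ.m≤m+n _ _)) ⟩
  J (2 + m) + 2 * J (1 + m)    ∎
  where open ℕ.≤-Reasoning

-- Written in `x = J (suc m)` and `y = J m`, the claim amounts to `y ≤ x`. The ratio 5/3 is attained
-- by `J 4 = 5` and `J 3 = 3`.
J-growth : ∀ m → 5 * J (2 + m) ≤ 3 * J (3 + m)
J-growth m = begin
  5 * (x + 2 * y)              ≡⟨ solve 2 (λ x y → con 5 :* (x :+ con 2 :* y)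
                                    := con 5 :* x :+ con 6 :* y :+ con 2 :* (con 2 :* y)) refl x y ⟩
  5 * x + 6 * y + 2 * (2 * y)  ≤⟨ ℕ.+-monoʳ-≤ (5 * x + 6 * y) (ℕ.*-monoʳ-≤ 2 2y≤2x) ⟩
  5 * x + 6 * y + 2 * (x + x)  ≡⟨ solve 2 (λ x y → con 5 :* x :+ con 6 :* y :+ con 2 :* (x :+ x)
                                    := con 3 :* (x :+ con 2 :* y :+ con 2 :* x)) refl x y ⟩
  3 * (x + 2 * y + 2 * x)      ∎
  where
  open ℕ.≤-Reasoning
  open ℕ.+-*-Solver
  x y : ℕ
  x = J (suc m)
  y = J m
  2y≤2x : 2 * y ≤ x + x
  2y≤2x = ℕ.≤-trans (proj₂ (J-suc-bounds m)) (ℕ.+-monoʳ-≤ x (0<J[1+m] m))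

-- After the recurrence is unfolded, only `y + 1 ≤ 2 * x` remains. The summand 1 on the left later
-- provides the strict gap in the lower bound.
5J+1≤2J[2+m] : ∀ m → 5 * J m + 1 ≤ 2 * J (2 + m)
5J+1≤2J[2+m] m = begin
  5 * y + 1                    ≡⟨ solve 1 (λ y → con 5 :* y :+ con 1 := y :+ con 1 :+ con 4 :* y) refl y ⟩
  y + 1 + 4 * y                ≤⟨ ℕ.+-monoˡ-≤ (4 * y) (ℕ.+-mono-≤ (J≤J[1+m] m) (0<J[1+m] m)) ⟩
  x + x + 4 * y                ≡⟨ solve 2 (λ x y → x :+ x :+ con 4 :* y := con 2 :* (x :+ con 2 :* y)) refl x y ⟩
  2 * (x + 2 * y)              ∎
  where
  open ℕ.≤-Reasoning
  open ℕ.+-*-Solver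
  x y : ℕ
  x = J (suc m)
  y = J m

J[2+m]<4[J+1] : ∀ m → J (2 + m) + 1 ≤ 4 * (J m + 1)
J[2+m]<4[J+1] m = begin
  x + 2 * y + 1                ≤⟨ ℕ.+-monoˡ-≤ 1 (ℕ.+-monoˡ-≤ (2 * y) (proj₁ (J-suc-bounds m))) ⟩
  -- The left side is now `4 * y + 2`, so the target exceeds it by exactly 2.
  2 * y + 1 + 2 * y + 1        ≤⟨ ℕ.m≤m+n _ 2 ⟩
  2 * y + 1 + 2 * y + 1 + 2    ≡⟨ solve 1 (λ y → con 2 :* y :+ con 1 :+ con 2 :* y :+ con 1 :+ con 2
                                    := con 4 :* (y :+ con 1)) refl y ⟩
  4 * (y + 1)                  ∎
  where
  open ℕ.≤-Reasoning
  open ℕ.+-*-Solver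
  x y : ℕ
  x = J (suc m)
  y = J m

-- Natural numbers inside the rationals, and the Archimedean property.

-- `fromℕ` normalises through a gcd that does not compute on a variable. Order and arithmetic are
-- therefore checked on the unnormalised fraction m/1 and carried back.
toℚᵘ-fromℕ : ∀ m → ℚ.toℚᵘ (fromℕ m) ℚᵘ.≃ ℚᵘ.mkℚᵘ (+ m) 0
toℚᵘ-fromℕ m = ℚ.toℚᵘ-fromℚᵘ (ℚᵘ.mkℚᵘ (+ m) 0)

fromℕ-mono-≤ : ∀ {m n} → m ≤ n → fromℕ m ℚ.≤ fromℕ n
fromℕ-mono-≤ {m} {n} m≤n = ℚ.toℚᵘ-cancel-≤
  (ℚᵘ.≤-respˡ-≃ (ℚᵘ.≃-sym (toℚᵘ-fromℕ m)) (ℚᵘ.≤-respʳ-≃ (ℚᵘ.≃-sym (toℚᵘ-fromℕ n))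
    (ℚᵘ.*≤* (ℤ.*-monoʳ-≤-nonNeg (+ 1) (ℤ.+≤+ m≤n)))))

fromℕ-+ : ∀ m n → fromℕ (m + n) ≡ fromℕ m ℚ.+ fromℕ n
fromℕ-+ m n = ℚ.toℚᵘ-injective (begin
  ℚ.toℚᵘ (fromℕ (m + n))
    ≈⟨ toℚᵘ-fromℕ (m + n) ⟩
  ℚᵘ.mkℚᵘ (+ (m + n)) 0
    ≈⟨ ℚᵘ.*≡* (cong (ℤ._* + 1) (sym (cong₂ ℤ._+_ (ℤ.*-identityʳ (+ m)) (ℤ.*-identityʳ (+ n))))) ⟩
  ℚᵘ.mkℚᵘ (+ m) 0 ℚᵘ.+ ℚᵘ.mkℚᵘ (+ n) 0
    ≈⟨ ℚᵘ.+-cong (ℚᵘ.≃-sym (toℚᵘ-fromℕ m)) (ℚᵘ.≃-sym (toℚᵘ-fromℕ n)) ⟩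
  ℚ.toℚᵘ (fromℕ m) ℚᵘ.+ ℚ.toℚᵘ (fromℕ n)
    ≈⟨ ℚᵘ.≃-sym (ℚ.toℚᵘ-homo-+ (fromℕ m) (fromℕ n)) ⟩
  ℚ.toℚᵘ (fromℕ m ℚ.+ fromℕ n) ∎)
  where open ℚᵘ.≃-Reasoning

fromℕ-* : ∀ m n → fromℕ (m * n) ≡ fromℕ m ℚ.* fromℕ n
fromℕ-* m n = ℚ.toℚᵘ-injective (begin
  ℚ.toℚᵘ (fromℕ (m * n))
    ≈⟨ toℚᵘ-fromℕ (m * n) ⟩
  ℚᵘ.mkℚᵘ (+ (m * n)) 0
    ≈⟨ ℚᵘ.*≡* (cong (ℤ._* + 1) (ℤ.pos-* m n)) ⟩
  ℚᵘ.mkℚᵘ (+ m) 0 ℚᵘ.* ℚᵘ.mkℚᵘ (+ n) 0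
    ≈⟨ ℚᵘ.*-cong (ℚᵘ.≃-sym (toℚᵘ-fromℕ m)) (ℚᵘ.≃-sym (toℚᵘ-fromℕ n)) ⟩
  ℚ.toℚᵘ (fromℕ m) ℚᵘ.* ℚ.toℚᵘ (fromℕ n)
    ≈⟨ ℚᵘ.≃-sym (ℚ.toℚᵘ-homo-* (fromℕ m) (fromℕ n)) ⟩
  ℚ.toℚᵘ (fromℕ m ℚ.* fromℕ n) ∎)
  where open ℚᵘ.≃-Reasoning

*-pos : ∀ {p q} → 0ℚ ℚ.< p → 0ℚ ℚ.< q → 0ℚ ℚ.< p ℚ.* q
*-pos {p} {q} 0<p 0<q = subst (ℚ._< p ℚ.* q) (ℚ.*-zeroˡ q)
  (ℚ.*-monoˡ-<-pos q {{ℚ.positive 0<q}} 0<p)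

-- A positive rational times its own denominator is its numerator, an integer that is at least 1.
-- The field `d` stores the denominator minus one, hence the witness `suc d`.
archimedean : ∀ ε → 0ℚ ℚ.< ε → ∃[ N ] 1ℚ ℚ.≤ ε ℚ.* fromℕ N
archimedean ε@(mkℚ (+ suc p) d c) _ = suc d , ℚ.toℚᵘ-cancel-≤
  (ℚᵘ.≤-respʳ-≃
    (ℚᵘ.≃-trans (ℚᵘ.*-congˡ {ℚ.toℚᵘ ε} (ℚᵘ.≃-sym (toℚᵘ-fromℕ (suc d))))
      (ℚᵘ.≃-sym (ℚ.toℚᵘ-homo-* ε (fromℕ (suc d)))))
    (ℚᵘ.*≤* (ℤ.+≤+ (subst₂ _≤_
      (sym (cong suc (trans (ℕ.+-identityʳ _) (ℕ.*-identityʳ d))))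
      (sym (ℕ.*-identityʳ _))
      (ℕ.m≤m+n (suc d) (p * suc d))))))
archimedean (mkℚ (+ zero) d c) (ℚ.*<* (ℤ.+<+ ()))
archimedean (mkℚ (ℤ.-[1+ p ]) d c) (ℚ.*<* ())

-- Reciprocals of positive rationals.

recip-inverseˡ-pos : ∀ {q} → 0ℚ ℚ.< q → recip q ℚ.* q ≡ 1ℚ
recip-inverseˡ-pos {q} 0<q = recip-inverseˡ q λ { refl → ℚ.<-irrefl refl 0<q }

recip-≤ : ∀ {q y} → 0ℚ ℚ.< q → 1ℚ ℚ.≤ y ℚ.* q → recip q ℚ.≤ y
recip-≤ {q} {y} 0<q h = ℚ.*-cancelʳ-≤-pos q {{ℚ.positive 0<q}}
  (subst (ℚ._≤ y ℚ.* q) (sym (recip-inverseˡ-pos 0<q)) h)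

recip-≥ : ∀ {q x} → 0ℚ ℚ.< q → x ℚ.* q ℚ.≤ 1ℚ → x ℚ.≤ recip q
recip-≥ {q} {x} 0<q h = ℚ.*-cancelʳ-≤-pos q {{ℚ.positive 0<q}}
  (subst (x ℚ.* q ℚ.≤_) (sym (recip-inverseˡ-pos 0<q)) h)

recip-pos : ∀ {q} → 0ℚ ℚ.< q → 0ℚ ℚ.< recip q
recip-pos {q} 0<q = ℚ.*-cancelʳ-<-nonNeg q {{ℚ.nonNegative (ℚ.<⇒≤ 0<q)}}
  (subst₂ ℚ._<_ (sym (ℚ.*-zeroˡ q)) (sym (recip-inverseˡ-pos 0<q)) (ℚ.positive⁻¹ 1ℚ))

-- Convergence of series with nonnegative terms.

∣-∣-within : ∀ {a b l w} → l ℚ.≤ a → a ℚ.≤ l ℚ.+ w → l ℚ.≤ b → b ℚ.≤ l ℚ.+ w →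
  ℚ.∣ a ℚ.- b ∣ ℚ.≤ w
∣-∣-within {a} {b} {l} {w} l≤a a≤ l≤b b≤ with ℚ.∣p∣≡p∨∣p∣≡-p (a ℚ.- b)
... | inj₁ eq = begin
  ℚ.∣ a ℚ.- b ∣       ≡⟨ eq ⟩
  a ℚ.- b             ≤⟨ ℚ.+-mono-≤ a≤ (ℚ.neg-antimono-≤ l≤b) ⟩
  l ℚ.+ w ℚ.- l       ≡⟨ solve 2 (λ l w → l :+ w :- l := w) refl l w ⟩
  w                   ∎
  where
  open ℚ.≤-Reasoning
  open +-*-Solver
... | inj₂ eq = begin
  ℚ.∣ a ℚ.- b ∣       ≡⟨ eq ⟩
  ℚ.- (a ℚ.- b)       ≡⟨ solve 2 (λ a b → :- (a :- b) := b :- a) refl a b ⟩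
  b ℚ.- a             ≤⟨ ℚ.+-mono-≤ b≤ (ℚ.neg-antimono-≤ l≤a) ⟩
  l ℚ.+ w ℚ.- l       ≡⟨ solve 2 (λ l w → l :+ w :- l := w) refl l w ⟩
  w                   ∎
  where
  open ℚ.≤-Reasoning
  open +-*-Solver

hasSum-partialSum : ∀ {a} (c : Cauchy (partialSum a)) → HasSum a (mkℝ (partialSum a) c)
-- Half of `ε` bounds the distance; the other half is the rational gap that `_<ℝ_` demands.
hasSum-partialSum {a} c ε 0<ε with c (ε ℚ.* ½) (*-pos 0<ε (ℚ.positive⁻¹ ½))
... | N , h = N , λ m N≤m → ε ℚ.* ½ , *-pos 0<ε (ℚ.positive⁻¹ ½) , N , λ k N≤k → begin
  ℚ.∣ partialSum a m ℚ.- partialSum a k ∣ ℚ.+ ε ℚ.* ½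
    ≤⟨ ℚ.+-monoˡ-≤ (ε ℚ.* ½) (ℚ.<⇒≤ (h m k N≤m N≤k)) ⟩
  ε ℚ.* ½ ℚ.+ ε ℚ.* ½
    ≡⟨ trans (sym (ℚ.*-distribˡ-+ ε ½ ½)) (ℚ.*-identityʳ ε) ⟩
  ε ∎
  where open ℚ.≤-Reasoning

-- T dominates the tails of ∑ a by telescoping.
module Domination (a T : ℕ → ℚ) (0≤a : ∀ i → 0ℚ ℚ.≤ a i) (0≤T : ∀ i → 0ℚ ℚ.≤ T i)
  (step : ∀ i → a i ℚ.+ T (suc i) ℚ.≤ T i) where

  open ℚ.≤-Reasoning

  partialSum-mono : ∀ {N m} → N ℕ.≤′ m → partialSum a N ℚ.≤ partialSum a m
  partialSum-mono         ℕ.≤′-refl            = ℚ.≤-refl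
  partialSum-mono {N} {suc m} (ℕ.≤′-step p) = begin
    partialSum a N             ≤⟨ partialSum-mono p ⟩
    partialSum a m             ≡⟨ sym (ℚ.+-identityʳ _) ⟩
    partialSum a m ℚ.+ 0ℚ      ≤⟨ ℚ.+-monoʳ-≤ (partialSum a m) (0≤a m) ⟩
    partialSum a m ℚ.+ a m     ∎

  -- By `step`, each new term `a m` is paid for by the drop from `T m` to `T (suc m)`.
  partialSum+T-antimono : ∀ {N m} → N ℕ.≤′ m →
    partialSum a m ℚ.+ T m ℚ.≤ partialSum a N ℚ.+ T N
  partialSum+T-antimono         ℕ.≤′-refl            = ℚ.≤-refl
  partialSum+T-antimono {N} {suc m} (ℕ.≤′-step p) = begin
    partialSum a m ℚ.+ a m ℚ.+ T (suc m)     ≡⟨ ℚ.+-assoc (partialSum a m) (a m) (T (suc m)) ⟩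
    partialSum a m ℚ.+ (a m ℚ.+ T (suc m))   ≤⟨ ℚ.+-monoʳ-≤ (partialSum a m) (step m) ⟩
    partialSum a m ℚ.+ T m                   ≤⟨ partialSum+T-antimono p ⟩
    partialSum a N ℚ.+ T N                   ∎

  partialSum-upper : ∀ {N m} → N ℕ.≤′ m → partialSum a m ℚ.≤ partialSum a N ℚ.+ T N
  partialSum-upper {N} {m} p = begin
    partialSum a m             ≡⟨ sym (ℚ.+-identityʳ _) ⟩
    partialSum a m ℚ.+ 0ℚ      ≤⟨ ℚ.+-monoʳ-≤ (partialSum a m) (0≤T m) ⟩
    partialSum a m ℚ.+ T m     ≤⟨ partialSum+T-antimono p ⟩
    partialSum a N ℚ.+ T N     ∎

  -- From index `N` on, all partial sums lie in one interval of width `T N`.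
  partialSum-cauchy : (∀ ε → 0ℚ ℚ.< ε → ∃[ N ] T N ℚ.< ε) → Cauchy (partialSum a)
  partialSum-cauchy T→0 ε 0<ε with T→0 ε 0<ε
  ... | N , TN<ε = N , λ m n N≤m N≤n → ℚ.≤-<-trans
    (∣-∣-within (partialSum-mono (ℕ.≤⇒≤′ N≤m)) (partialSum-upper (ℕ.≤⇒≤′ N≤m))
                (partialSum-mono (ℕ.≤⇒≤′ N≤n)) (partialSum-upper (ℕ.≤⇒≤′ N≤n)))
    TN<ε

-- The tail series starting at index 2 + m.

module Tail (m : ℕ) where

  5/2 2/5 3/5 1/5 : ℚ
  5/2 = + 5 ℚ./ 2
  2/5 = + 2 ℚ./ 5
  3/5 = + 3 ℚ./ 5
  1/5 = + 1 ℚ./ 5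

  open ℚ.≤-Reasoning
  open +-*-Solver

  -- `T i` is the geometric majorant of the tail from `a i` on: its factor 5/2 is 1 + 3/5 + (3/5)^2
  -- + ..., the solution of c = 1 + (3/5) c.
  j a T : ℕ → ℚ
  j i = fromℕ (J (2 + m + i))
  a   = tailTerm (2 + m)
  T i = 5/2 ℚ.* a i

  0<j : ∀ i → 0ℚ ℚ.< j i
  0<j i = ℚ.<-≤-trans (ℚ.positive⁻¹ 1ℚ) (fromℕ-mono-≤ (0<J[1+m] (suc (m + i))))

  0<a : ∀ i → 0ℚ ℚ.< a i
  0<a i = recip-pos (0<j i)

  0≤T : ∀ i → 0ℚ ℚ.≤ T i
  0≤T i = ℚ.<⇒≤ (*-pos (ℚ.positive⁻¹ 5/2) (0<a i))

  j-growth : ∀ i → fromℕ 5 ℚ.* j i ℚ.≤ fromℕ 3 ℚ.* j (suc i)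
  j-growth i = subst₂ ℚ._≤_ (fromℕ-* 5 (J (2 + m + i)))
    (fromℕ-* 3 (J (2 + m + suc i)))
    (fromℕ-mono-≤ (subst (λ k → 5 * J (2 + m + i) ≤ 3 * J (2 + k)) (sym (ℕ.+-suc m i))
      (J-growth (m + i))))

  a-decay : ∀ i → a (suc i) ℚ.≤ 3/5 ℚ.* a i
  a-decay i = recip-≤ (0<j (suc i)) (begin
    1ℚ                                          ≡⟨ sym (recip-inverseˡ-pos (0<j i)) ⟩
    a i ℚ.* j i                                 ≡⟨ solve 2 (λ a j → a :* j := con 1/5 :* a :* (con (fromℕ 5) :* j)) refl (a i) (j i) ⟩
    1/5 ℚ.* a i ℚ.* (fromℕ 5 ℚ.* j i)           ≤⟨ ℚ.*-monoˡ-≤-nonNeg (1/5 ℚ.* a i)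
                                                     {{ℚ.nonNegative (ℚ.<⇒≤ (*-pos (ℚ.positive⁻¹ 1/5) (0<a i)))}}
                                                     (j-growth i) ⟩
    1/5 ℚ.* a i ℚ.* (fromℕ 3 ℚ.* j (suc i))     ≡⟨ solve 2 (λ a j → con 1/5 :* a :* (con (fromℕ 3) :* j) := con 3/5 :* a :* j) refl (a i) (j (suc i)) ⟩
    3/5 ℚ.* a i ℚ.* j (suc i)                   ∎)

  T-step : ∀ i → a i ℚ.+ T (suc i) ℚ.≤ T i
  T-step i = begin
    a i ℚ.+ 5/2 ℚ.* a (suc i)          ≤⟨ ℚ.+-monoʳ-≤ (a i) (ℚ.*-monoˡ-≤-nonNeg 5/2 (a-decay i)) ⟩
    a i ℚ.+ 5/2 ℚ.* (3/5 ℚ.* a i)      ≡⟨ solve 1 (λ a → a :+ con 5/2 :* (con 3/5 :* a) := con 5/2 :* a) refl (a i) ⟩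
    5/2 ℚ.* a i                        ∎

  T→0 : ∀ ε → 0ℚ ℚ.< ε → ∃[ N ] T N ℚ.< ε
  -- Getting `a N` below `ε`/5 bounds `T N` by `ε`/2, which leaves room for strictness.
  T→0 ε 0<ε with archimedean (ε ℚ.* 1/5) (*-pos 0<ε (ℚ.positive⁻¹ 1/5))
  ... | N , h = N , (begin-strict
    5/2 ℚ.* a N             ≤⟨ ℚ.*-monoˡ-≤-nonNeg 5/2 (recip-≤ {y = ε ℚ.* 1/5} (0<j N) 1≤) ⟩
    5/2 ℚ.* (ε ℚ.* 1/5)     ≡⟨ solve 1 (λ ε → con 5/2 :* (ε :* con 1/5) := con ½ :* ε) refl ε ⟩
    ½ ℚ.* ε                 <⟨ ℚ.*-monoˡ-<-pos ε {{ℚ.positive 0<ε}} ½<1 ⟩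
    1ℚ ℚ.* ε                ≡⟨ ℚ.*-identityˡ ε ⟩
    ε                       ∎)
    where
    ½<1 : ½ ℚ.< 1ℚ
    ½<1 = ℚ.*<* (ℤ.+<+ (s≤s (s≤s z≤n)))
    1≤ : 1ℚ ℚ.≤ ε ℚ.* 1/5 ℚ.* j N
    1≤ = ℚ.≤-trans h (ℚ.*-monoˡ-≤-nonNeg (ε ℚ.* 1/5)
      {{ℚ.nonNegative (ℚ.<⇒≤ (*-pos 0<ε (ℚ.positive⁻¹ 1/5)))}}
      (fromℕ-mono-≤ (ℕ.≤-trans (ℕ.m≤n+m N m) (ℕ.<⇒≤ (m<J[2+m] (m + N))))))

  open Domination a T (λ i → ℚ.<⇒≤ (0<a i)) 0≤T T-step

  S : ℝ
  S = mkℝ (partialSum a) (partialSum-cauchy T→0)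

  -- Bounds for the sum and its inverse.

  -- Index 0 is excluded because the empty partial sum is 0; from index 1 on, the first term is
  -- included.
  a₀≤S : ∀ k → 1 ≤ k → a 0 ℚ.≤ seq S k
  a₀≤S k 1≤k = subst (ℚ._≤ seq S k) (ℚ.+-identityˡ (a 0)) (partialSum-mono (ℕ.≤⇒≤′ 1≤k))

  S≤T₀ : ∀ k → seq S k ℚ.≤ T 0
  S≤T₀ k = subst (seq S k ℚ.≤_) (ℚ.+-identityˡ (T 0)) (partialSum-upper (ℕ.≤⇒≤′ (z≤n {k})))

  0<S : ∀ k → 1 ≤ k → 0ℚ ℚ.< seq S k
  0<S k 1≤k = ℚ.<-≤-trans (0<a 0) (a₀≤S k 1≤k)

  S#0 : S # ι 0ℚ
  S#0 = inj₂ (a 0 , 0<a 0 , 1 , λ k 1≤k →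
    subst (ℚ._≤ seq S k) (sym (ℚ.+-identityˡ (a 0))) (a₀≤S k 1≤k))

  -- Since `inv` acts termwise, bounding the reciprocal of every nonempty partial sum suffices, with
  -- no passage to the limit. The constant 2/5 inverts the factor 5/2 in `T 0`.
  2/5j₀≤recipS : ∀ k → 1 ≤ k → 2/5 ℚ.* j 0 ℚ.≤ recip (seq S k)
  2/5j₀≤recipS k 1≤k = recip-≥ (0<S k 1≤k) (begin
    2/5 ℚ.* j 0 ℚ.* seq S k            ≤⟨ ℚ.*-monoˡ-≤-nonNeg (2/5 ℚ.* j 0)
                                            {{ℚ.nonNegative (ℚ.<⇒≤ (*-pos (ℚ.positive⁻¹ 2/5) (0<j 0)))}}
                                            (S≤T₀ k) ⟩
    2/5 ℚ.* j 0 ℚ.* (5/2 ℚ.* a 0)      ≡⟨ solve 2 (λ a j → con 2/5 :* j :* (con 5/2 :* a) := a :* j) refl (a 0) (j 0) ⟩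
    a 0 ℚ.* j 0                        ≡⟨ recip-inverseˡ-pos (0<j 0) ⟩
    1ℚ                                 ∎)

  recipS≤j₀ : ∀ k → 1 ≤ k → recip (seq S k) ℚ.≤ j 0
  recipS≤j₀ k 1≤k = recip-≤ (0<S k 1≤k) (begin
    1ℚ                    ≡⟨ sym (recip-inverseˡ-pos (0<j 0)) ⟩
    a 0 ℚ.* j 0           ≡⟨ ℚ.*-comm (a 0) (j 0) ⟩
    j 0 ℚ.* a 0           ≤⟨ ℚ.*-monoˡ-≤-nonNeg (j 0) {{ℚ.nonNegative (ℚ.<⇒≤ (0<j 0))}} (a₀≤S k 1≤k) ⟩
    j 0 ℚ.* seq S k       ∎)

  j₀≡ : j 0 ≡ fromℕ (J (2 + m))
  j₀≡ = cong (λ k → fromℕ (J (2 + k))) (ℕ.+-identityʳ m)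

  lower : ι (fromℕ (J m)) <ℝ inv S S#0
  -- The gap 1/5 is the spare 1 of `5J+1≤2J[2+m]` after division by 5.
  lower = 1/5 , ℚ.positive⁻¹ 1/5 , 1 , λ k 1≤k → begin
    x ℚ.+ 1/5                               ≡⟨ solve 1 (λ x → x :+ con 1/5 := con 1/5 :* (con (fromℕ 5) :* x :+ con 1ℚ)) refl x ⟩
    1/5 ℚ.* (fromℕ 5 ℚ.* x ℚ.+ 1ℚ)          ≡⟨ cong (λ t → 1/5 ℚ.* (t ℚ.+ 1ℚ)) (sym (fromℕ-* 5 (J m))) ⟩
    1/5 ℚ.* (fromℕ (5 * J m) ℚ.+ 1ℚ)        ≡⟨ cong (1/5 ℚ.*_) (sym (fromℕ-+ (5 * J m) 1)) ⟩
    1/5 ℚ.* fromℕ (5 * J m + 1)             ≤⟨ ℚ.*-monoˡ-≤-nonNeg 1/5 (fromℕ-mono-≤ (5J+1≤2J[2+m] m)) ⟩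
    1/5 ℚ.* fromℕ (2 * J (2 + m))           ≡⟨ cong (1/5 ℚ.*_) (fromℕ-* 2 (J (2 + m))) ⟩
    1/5 ℚ.* (fromℕ 2 ℚ.* fromℕ (J (2 + m))) ≡⟨ solve 1 (λ y → con 1/5 :* (con (fromℕ 2) :* y) := con 2/5 :* y) refl (fromℕ (J (2 + m))) ⟩
    2/5 ℚ.* fromℕ (J (2 + m))               ≡⟨ cong (2/5 ℚ.*_) (sym j₀≡) ⟩
    2/5 ℚ.* j 0                             ≤⟨ 2/5j₀≤recipS k 1≤k ⟩
    recip (seq S k)                         ∎
    where
    x : ℚ
    x = fromℕ (J m)

  upper : inv S S#0 <ℝ ι (fromℕ (4 * (J m + 1)))
  -- The gap 1 is the summand on the left of `J[2+m]<4[J+1]`.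
  upper = 1ℚ , ℚ.positive⁻¹ 1ℚ , 1 , λ k 1≤k → begin
    recip (seq S k) ℚ.+ 1ℚ        ≤⟨ ℚ.+-monoˡ-≤ 1ℚ (recipS≤j₀ k 1≤k) ⟩
    j 0 ℚ.+ 1ℚ                    ≡⟨ cong (ℚ._+ 1ℚ) j₀≡ ⟩
    fromℕ (J (2 + m)) ℚ.+ 1ℚ      ≡⟨ sym (fromℕ-+ (J (2 + m)) 1) ⟩
    fromℕ (J (2 + m) + 1)         ≤⟨ fromℕ-mono-≤ (J[2+m]<4[J+1] m) ⟩
    fromℕ (4 * (J m + 1))         ∎

theorem2p1 : (n : ℕ) → 2 ≤ n →
    Σ[ S ∈ ℝ ] (HasSum (tailTerm n) S ×
    (Σ[ S#0 ∈ S # ι 0ℚ ]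
    (ι (fromℕ (J (n ∸ 2))) <ℝ inv S S#0 ×
    inv S S#0 <ℝ ι (fromℕ (4 * (J (n ∸ 2) + 1))))))
-- With n = 2 + m, the index `n ∸ 2` reduces to `m`.
theorem2p1 (suc (suc m)) _ = S , hasSum-partialSum (cauchy S) , S#0 , lower , upper
  where open Tail m
theorem2p1 (suc zero) (s≤s ())
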